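{- For the two-bishop game graph $G(B(a,b),B_Lb_D)$ on an $a\times b$ grid: \begin{enumerate} \item If $n>1$ then $\beta(G(B(2,n),B_Lb_D))=2$. \item $\beta(G(B(3,3),B_Lb_D))=\beta(G(B(3,4),B_Lb_D))=3$. \end{enumerate}
   Context: The bishop graph $B(a,b)$ is the simple graph whose vertices are the squares of an $a\times b$ grid, two distinct squares being adjacent if and only if a bishop can move from one to the other, i.e. they lie on a common diagonal (in any diagonal direction, at any distance): squares $(i,j)\ne(i',j')$ are adjacent iff $|i-i'|=|j-j'|$. Colour the squares light and dark as on a chessboard (by the parity of $i+j$). $B_L(a,b)$ and $B_D(a,b)$ denote the subgraphs of $B(a,b)$ induced on the light and on the dark squares, respectively. $B_Lb_D$ denotes the position with one bishop on a light square and an opposing bishop on a dark square (so that they never threaten each other). The game graph $G(B(a,b),B_Lb_D)$ is taken to be the simple undirected graph $B_L(a,b)\,\square\,B_D(a,b)$ (Cartesian product). Metric dimension: for an ordered set $S=(u_1,\dots,u_k)$ of vertices of a connected simple graph $G$, the distance vector of a vertex $v$ is $(d(u_1,v),\dots,d(u_k,v))$, where $d$ is the usual graph distance. $S$ is a resolving set if distinct vertices have distinct distance vectors. The metric dimension $\beta(G)$ is the minimum cardinality of a resolving set. -}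

module Defs where

open import Data.Fin.Base using (Fin; toℕ)
open import Data.Nat.Base using (ℕ; zero; suc; _+_; _≤_; ∣_-_∣; parity)
open import Data.Nat.Properties using (∣-∣-comm)
open import Data.Parity.Base using (Parity; 0ℙ; 1ℙ)
open import Data.Product.Base using (Σ-syntax; ∃-syntax; _×_; _,_; proj₁; proj₂)
open import Data.Refinement using (Refinement-syntax; value)
open import Data.Sum.Base using (_⊎_; inj₁; inj₂)
open import Data.Vec.Base using (Vec)
open import Data.Vec.Relation.Binary.Pointwise.Inductive using (Pointwise)
open import Data.Vec.Relation.Unary.Unique.Propositional using (Unique)
open import Relation.Binary.Definitions using (Symmetric; Irreflexive)
open import Relation.Binary.PropositionalEquality
  using (_≡_; _≢_; sym; trans; cong; ≢-sym)

record SimpleGraph : Set₁ where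
  field
    Vertex  : Set
    Adj     : Vertex → Vertex → Set
    adj-sym : Symmetric Adj
    adj-irr : Irreflexive _≡_ Adj

open SimpleGraph public

-- The proof of P is irrelevant, so each vertex of G satisfying P occurs
-- exactly once.
induced : (G : SimpleGraph) → (Vertex G → Set) → SimpleGraph
induced G P = record
  { Vertex  = [ v ∈ Vertex G ∣ P v ]
  ; Adj     = λ u v → Adj G (value u) (value v)
  ; adj-sym = adj-sym G
  ; adj-irr = λ u≡v → adj-irr G (cong value u≡v)
  }

infixr 6 _□_

_□_ : SimpleGraph → SimpleGraph → SimpleGraph
G □ H = record
  { Vertex  = Vertex G × Vertex H
  ; Adj     = λ (u , v) (u′ , v′) →
                (Adj G u u′ × v ≡ v′) ⊎ (u ≡ u′ × Adj H v v′)
  ; adj-sym = λ { (inj₁ (a , e)) → inj₁ (adj-sym G a , sym e)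
                ; (inj₂ (e , a)) → inj₂ (sym e , adj-sym H a) }
  ; adj-irr = λ { p (inj₁ (a , _)) → adj-irr G (cong proj₁ p) a
                ; p (inj₂ (_ , a)) → adj-irr H (cong proj₂ p) a }
  }

data Walk (G : SimpleGraph) : Vertex G → Vertex G → ℕ → Set where
  []  : ∀ {u} → Walk G u u zero
  _∷_ : ∀ {u v w n} → Adj G u v → Walk G v w n → Walk G u w (suc n)

Connected : SimpleGraph → Set
Connected G = ∀ u v → ∃[ n ] Walk G u v n

-- d(u,v) = n
IsDistance : (G : SimpleGraph) → Vertex G → Vertex G → ℕ → Set
IsDistance G u v n = Walk G u v n × (∀ m → Walk G u v m → n ≤ m)

IsDistanceVector : (G : SimpleGraph) {k : ℕ} →
                   Vec (Vertex G) k → Vertex G → Vec ℕ k → Set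
IsDistanceVector G S v ds = Pointwise (λ u d → IsDistance G u v d) S ds

-- Intended for connected G, where every vertex has a distance vector.
Resolving : (G : SimpleGraph) {k : ℕ} → Vec (Vertex G) k → Set
Resolving G {k} S =
  ∀ (v w : Vertex G) → v ≢ w →
  ∀ (ds es : Vec ℕ k) →
  IsDistanceVector G S v ds → IsDistanceVector G S w es → ds ≢ es

HasResolvingSetOfSize : SimpleGraph → ℕ → Set
HasResolvingSetOfSize G k = Σ[ S ∈ Vec (Vertex G) k ] Unique S × Resolving G S

-- β(G) = k.  Metric dimension is only defined for connected graphs, so
-- connectedness is part of the assertion.
HasMetricDimension : SimpleGraph → ℕ → Set
HasMetricDimension G k =
  Connected G ×
  HasResolvingSetOfSize G k ×
  (∀ m → HasResolvingSetOfSize G m → k ≤ m)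

Square : ℕ → ℕ → Set
Square a b = Fin a × Fin b

bishopGraph : ℕ → ℕ → SimpleGraph
bishopGraph a b = record
  { Vertex  = Square a b
  ; Adj     = λ s@(i , j) s′@(i′ , j′) →
                s ≢ s′ × ∣ toℕ i - toℕ i′ ∣ ≡ ∣ toℕ j - toℕ j′ ∣
  ; adj-sym = λ { {i , j} {i′ , j′} (s≢s′ , e) →
                ≢-sym s≢s′ ,
                trans (∣-∣-comm (toℕ i′) (toℕ i))
                      (trans e (∣-∣-comm (toℕ j) (toℕ j′))) }
  ; adj-irr = λ s≡s′ (s≢s′ , _) → s≢s′ s≡s′
  }

-- Coordinates start at 0; i + j has the same parity as with both
-- coordinates starting at 1.
squareParity : ∀ {a b} → Square a b → Parity
squareParity (i , j) = parity (toℕ i + toℕ j)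

-- Which parity is called light is a convention; exchanging the two swaps
-- the factors of the game graph.
Light Dark : ∀ {a b} → Square a b → Set
Light s = squareParity s ≡ 0ℙ
Dark  s = squareParity s ≡ 1ℙ

lightBishopGraph darkBishopGraph : ℕ → ℕ → SimpleGraph
lightBishopGraph a b = induced (bishopGraph a b) Light
darkBishopGraph  a b = induced (bishopGraph a b) Dark

-- G(B(a,b), B_L b_D)
gameGraph : ℕ → ℕ → SimpleGraph
gameGraph a b = lightBishopGraph a b □ darkBishopGraph a b

{-# OPTIONS --safe #-}

-- A 2 × n board has one square of each colour in every column, so both
-- factors of the game graph are paths and the game graph is an n × n grid:
-- no single vertex resolves it, because every vertex has a neighbour in each
-- of the two directions, while two corners on a common side do.
--
-- On the 3 × 3 and 3 × 4 boards both factors have diameter 2, so distances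
-- in the game graph are at most 4.  Under a resolving set {u₁ , u₂} only uᵢ
-- has a distance vector with i-th entry 0, which leaves at most 2 + 4² = 18
-- vectors for 5 · 4 respectively 6 · 6 vertices.

module Submission where

open import Defs
open import Data.Bool.Base using (if_then_else_)
open import Data.Fin.Base
  using (Fin; zero; suc; toℕ; fromℕ; fromℕ<; combine; remQuot)
import Data.Fin.Properties as Fin
open import Data.Irrelevant using ([_])
open import Data.Nat.Base
  using (ℕ; zero; suc; _+_; _*_; _∸_; _≤_; _<_; z≤n; s≤s; z<s; ∣_-_∣; parity)
open import Data.Nat.Properties renaming (_≟_ to _≟ℕ_)
open import Data.Nat.Tactic.RingSolver using (solve-∀)
open import Data.Parity.Base as ℙ using (Parity; 0ℙ; 1ℙ; _⁻¹)
import Data.Parity.Properties as ℙ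
open import Data.Product.Base
  using (∃-syntax; _×_; _,_; proj₁; proj₂; uncurry)
open import Data.Product.Properties using (≡-dec)
open import Data.Refinement as Refinement using (value; value-injective; _,_)
open import Data.Sum.Base using (_⊎_; inj₁; inj₂)
open import Data.Vec.Base as Vec using (Vec; []; _∷_; map; lookup)
open import Data.Vec.Properties using (∷-injective)
import Data.Vec.Properties as Vec
open import Data.Vec.Relation.Binary.Pointwise.Inductive using ([]; _∷_)
open import Data.Vec.Relation.Unary.All using ([]; _∷_)
open import Data.Vec.Relation.Unary.AllPairs using ([]; _∷_)
open import Data.Vec.Relation.Unary.Unique.Propositional using (Unique)
open import Function.Base using (_∘_)
open import Function.Definitions using (Injective)
open import Relation.Binary.Definitions using (Decidable; DecidableEquality)
open import Relation.Binary.PropositionalEquality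
open import Relation.Nullary.Decidable
  using ( Dec; yes; no; does; map′; recompute; decidable-stable; toWitness
       ; True; ¬?; _×-dec_; _⊎-dec_; _→-dec_)
open import Relation.Nullary.Negation using (¬_; contradiction)

private
  variable
    G H : SimpleGraph
    k l m n : ℕ

-- Walks and distances

module _ {G : SimpleGraph} where

  infixr 5 _++_

  _++_ : ∀ {u v w} → Walk G u v m → Walk G v w n → Walk G u w (m + n)
  []      ++ q = q
  (a ∷ p) ++ q = a ∷ (p ++ q)

  walk-zero : ∀ {u v} → Walk G u v 0 → u ≡ v
  walk-zero [] = refl

walk-□ˡ : ∀ {u u′} v → Walk G u u′ n → Walk (G □ H) (u , v) (u′ , v) n
walk-□ˡ v []      = []
walk-□ˡ v (a ∷ p) = inj₁ (a , refl) ∷ walk-□ˡ v p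

walk-□ʳ : ∀ u {v v′} → Walk H v v′ n → Walk (G □ H) (u , v) (u , v′) n
walk-□ʳ u []      = []
walk-□ʳ u (a ∷ p) = inj₂ (refl , a) ∷ walk-□ʳ u p

-- Every step of a walk in the product moves in exactly one factor, so sorting the steps by factor
-- gives two walks whose lengths add up. This is the lower bound for distances in `G □ H`.
walk-split : ∀ {u u′ v v′} → Walk (G □ H) (u , v) (u′ , v′) n →
             ∃[ k ] ∃[ l ] Walk G u u′ k × Walk H v v′ l × k + l ≡ n
walk-split [] = 0 , 0 , [] , [] , refl
walk-split (inj₁ (a , refl) ∷ p) with walk-split p
... | k , l , q , r , refl = suc k , l , a ∷ q , r , refl
walk-split (inj₂ (refl , a) ∷ p) with walk-split p
... | k , l , q , r , refl = k , suc l , q , a ∷ r , +-suc k l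

-- Bundling a computable distance function with its correctness yields connectedness and decidable
-- equality of vertices, and lets distance vectors be computed.
record Metric (G : SimpleGraph) : Set where
  field
    dist     : Vertex G → Vertex G → ℕ
    shortest : ∀ u v → IsDistance G u v (dist u v)

  dist≡0⇒≡ : ∀ {u v} → dist u v ≡ 0 → u ≡ v
  dist≡0⇒≡ {u} {v} eq = walk-zero (subst (Walk G u v) eq (proj₁ (shortest u v)))

  ≡⇒dist≡0 : ∀ {u v} → u ≡ v → dist u v ≡ 0
  ≡⇒dist≡0 {u} refl = n≤0⇒n≡0 (proj₂ (shortest u u) 0 [])

  _≟_ : DecidableEquality (Vertex G)
  u ≟ v = map′ dist≡0⇒≡ ≡⇒dist≡0 (dist u v ≟ℕ 0)

  adj⇒dist≡1 : ∀ {u v} → Adj G u v → dist u v ≡ 1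
  adj⇒dist≡1 {u} {v} a = ≤-antisym
    (proj₂ (shortest u v) 1 (a ∷ []))
    (n≢0⇒n>0 λ eq → adj-irr G (dist≡0⇒≡ eq) a)

  connected : Connected G
  connected u v = dist u v , proj₁ (shortest u v)

  vector : Vec (Vertex G) k → Vertex G → Vec ℕ k
  vector S v = map (λ u → dist u v) S

  isDistanceVector : ∀ (S : Vec (Vertex G) k) v →
                     IsDistanceVector G S v (vector S v)
  isDistanceVector []      v = []
  isDistanceVector (u ∷ S) v = shortest u v ∷ isDistanceVector S v

  distanceVector-unique : ∀ {S : Vec (Vertex G) k} {v ds} →
                          IsDistanceVector G S v ds → ds ≡ vector S v
  distanceVector-unique [] = refl
  distanceVector-unique {S = u ∷ _} {v} ((p , min) ∷ ds) = cong₂ _∷_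
    (≤-antisym (min _ (proj₁ (shortest u v))) (proj₂ (shortest u v) _ p))
    (distanceVector-unique ds)

  -- Distance vectors are unique, so `Resolving`, which quantifies over all of them, amounts to
  -- injectivity of the computed `vector`.
  injective⇒resolving : ∀ {S : Vec (Vertex G) k} →
                        Injective _≡_ _≡_ (vector S) → Resolving G S
  injective⇒resolving inj v w v≢w ds es v-ds w-es ds≡es = v≢w (inj (trans
    (sym (distanceVector-unique v-ds))
    (trans ds≡es (distanceVector-unique w-es))))

  resolving⇒injective : ∀ {S : Vec (Vertex G) k} →
                        Resolving G S → Injective _≡_ _≡_ (vector S)
  resolving⇒injective {S = S} res {v} {w} eq =
    -- `Resolving` only refutes `v ≢ w`; decidable equality turns this into `v ≡ w`.
    decidable-stable (v ≟ w) λ v≢w →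
      res v w v≢w _ _ (isDistanceVector S v) (isDistanceVector S w) eq

open Metric

-- Distances add in a Cartesian product: a shortest walk may first finish in `G` and then move in
-- `H`, and `walk-split` shows that nothing shorter exists.
_⊞_ : Metric G → Metric H → Metric (G □ H)
M ⊞ N = record
  { dist     = λ (u , v) (u′ , v′) → dist M u u′ + dist N v v′
  ; shortest = λ (u , v) (u′ , v′) →
      (walk-□ˡ v (proj₁ (shortest M u u′)) ++ walk-□ʳ u′ (proj₁ (shortest N v v′)))
      , λ n p → let k , l , q , r , eq = walk-split p in
          ≤-trans (+-mono-≤ (proj₂ (shortest M u u′) k q)
                            (proj₂ (shortest N v v′) l r))
                  (≤-reflexive eq)
  }

-- Metric dimension

resolving-∷ : ∀ {S : Vec (Vertex G) k} u → Resolving G S → Resolving G (u ∷ S)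
resolving-∷ u res v w v≢w (_ ∷ ds) (_ ∷ es) (_ ∷ v-ds) (_ ∷ w-es) eq =
  res v w v≢w ds es v-ds w-es (proj₂ (∷-injective eq))

resolving-pad : ∀ {S : Vec (Vertex G) k} → Vertex G → Resolving G S →
                ∀ j → ∃[ T ] Resolving G {j + k} T
resolving-pad u res zero    = _ , res
resolving-pad u res (suc j) =
  let T , res′ = resolving-pad u res j in u ∷ T , resolving-∷ u res′

-- It suffices to exclude resolving vectors of length exactly `k`: a shorter one would stay
-- resolving when padded to length `k` with copies of a vertex.
metricDimension : Metric G → {S : Vec (Vertex G) (suc k)} → Unique S →
                  Resolving G S →
                  (∀ (T : Vec (Vertex G) k) → ¬ Resolving G T) →
                  HasMetricDimension G (suc k)
metricDimension {G} {k} M {S} S! res ¬res = connected M , (S , S! , res) , lower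
  where
  lower : ∀ m → HasResolvingSetOfSize G m → k < m
  lower m (T , _ , res′) = ≰⇒> λ m≤k →
    let T′ , res″ = resolving-pad (Vec.head S) res′ (k ∸ m)
    in ¬-at (m∸n+n≡m m≤k) T′ res″
    where
    ¬-at : ∀ {j} → j ≡ k → (T′ : Vec (Vertex G) j) → ¬ Resolving G T′
    ¬-at refl = ¬res

-- Colour classes

colourClass : Parity → ℕ → ℕ → SimpleGraph
colourClass p a b = induced (bishopGraph a b) (λ s → squareParity s ≡ p)

module _ {p : Parity} {a b : ℕ} where

  -- The parity proof stored in a vertex is irrelevant; deciding the parity again makes it usable.
  parity-proof : (v : Vertex (colourClass p a b)) → squareParity (value v) ≡ p
  parity-proof (s , [ e ]) = recompute (squareParity s ℙ.≟ p) e

-- Boards with two rows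

module TwoRows (p : Parity) (n : ℕ) where

  P : SimpleGraph
  P = colourClass p 2 n

  column : Vertex P → ℕ
  column v = toℕ (proj₂ (value v))

  row : Parity → Fin 2
  row 0ℙ = zero
  row 1ℙ = suc zero

  row-parity : ∀ i → row (parity (toℕ i)) ≡ i
  row-parity zero       = refl
  row-parity (suc zero) = refl

  parity-row : ∀ q → parity (toℕ (row q)) ≡ q
  parity-row 0ℙ = refl
  parity-row 1ℙ = refl

  at-parity : ∀ c → parity (toℕ (row (p ℙ.+ parity c)) + c) ≡ p
  at-parity c = begin
    parity (toℕ (row q) + c)            ≡⟨ ℙ.+-homo-+ (toℕ (row q)) c ⟩
    parity (toℕ (row q)) ℙ.+ parity c   ≡⟨ cong (ℙ._+ parity c) (parity-row q) ⟩
    p ℙ.+ parity c ℙ.+ parity c         ≡⟨ cancel p (parity c) ⟩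
    p                                   ∎
    where
    open ≡-Reasoning
    q = p ℙ.+ parity c
    cancel : ∀ p q → p ℙ.+ q ℙ.+ q ≡ p
    cancel 0ℙ 0ℙ = refl
    cancel 0ℙ 1ℙ = refl
    cancel 1ℙ 0ℙ = refl
    cancel 1ℙ 1ℙ = refl

  at : Fin n → Vertex P
  at j = (row (p ℙ.+ parity (toℕ j)) , j) , [ at-parity (toℕ j) ]

  -- Modulo 2, `i + j = p` gives `i = p + j`, and with two rows the parity of `i` is `i` itself.
  -- Hence the column determines the vertex within its colour class.
  row-of : ∀ v → proj₁ (value v) ≡ row (p ℙ.+ parity (column v))
  row-of v@((i , j) , _) = begin
    i                             ≡⟨ row-parity i ⟨
    row (parity (toℕ i))          ≡⟨ cong row (solve (parity (toℕ i)) (parity (toℕ j)) eq) ⟩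
    row (p ℙ.+ parity (toℕ j))    ∎
    where
    open ≡-Reasoning
    eq : parity (toℕ i) ℙ.+ parity (toℕ j) ≡ p
    eq = trans (sym (ℙ.+-homo-+ (toℕ i) (toℕ j))) (parity-proof v)
    solve : ∀ q r → q ℙ.+ r ≡ p → q ≡ p ℙ.+ r
    solve 0ℙ 0ℙ refl = refl
    solve 0ℙ 1ℙ refl = refl
    solve 1ℙ 0ℙ refl = refl
    solve 1ℙ 1ℙ refl = refl

  column-injective : Injective _≡_ _≡_ column
  column-injective {u} {v} eq = value-injective (cong₂ _,_
    (trans (row-of u) (trans (cong (λ c → row (p ℙ.+ parity c)) eq) (sym (row-of v))))
    (Fin.toℕ-injective eq))

  -- Moving one column on flips the parity, hence the row, so both coordinates differ by 1.
  column-adj : ∀ u v → column v ≡ suc (column u) → Adj P u v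
  column-adj u v eq =
    (λ u≡v → 1+n≢n (trans (sym eq) (cong (toℕ ∘ proj₂) (sym u≡v)))) ,
    trans row-gap (sym column-gap)
    where
    open ≡-Reasoning
    r = p ℙ.+ parity (column u)
    flip : ∀ p q → p ℙ.+ (q ⁻¹) ≡ (p ℙ.+ q) ⁻¹
    flip 0ℙ _  = refl
    flip 1ℙ _  = refl
    gap : ∀ q → ∣ toℕ (row q) - toℕ (row (q ⁻¹)) ∣ ≡ 1
    gap 0ℙ = refl
    gap 1ℙ = refl
    parity-suc : ∀ m → parity (suc m) ≡ parity m ⁻¹
    parity-suc m = trans (sym (ℙ.⁻¹-involutive _)) (cong _⁻¹ (ℙ.suc-homo-⁻¹ m))
    row-v : proj₁ (value v) ≡ row (r ⁻¹)
    row-v = begin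
      proj₁ (value v)                          ≡⟨ row-of v ⟩
      row (p ℙ.+ parity (column v))            ≡⟨ cong (λ c → row (p ℙ.+ parity c)) eq ⟩
      row (p ℙ.+ parity (suc (column u)))      ≡⟨ cong (λ q → row (p ℙ.+ q)) (parity-suc (column u)) ⟩
      row (p ℙ.+ (parity (column u) ⁻¹))       ≡⟨ cong row (flip p (parity (column u))) ⟩
      row (r ⁻¹)                               ∎
    row-gap : ∣ toℕ (proj₁ (value u)) - toℕ (proj₁ (value v)) ∣ ≡ 1
    row-gap = trans (cong₂ (λ i i′ → ∣ toℕ i - toℕ i′ ∣) (row-of u) row-v) (gap r)
    column-gap : ∣ column u - column v ∣ ≡ 1
    column-gap = begin
      ∣ column u - column v ∣         ≡⟨ cong (∣ column u -_∣) eq ⟩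
      ∣ column u - suc (column u) ∣   ≡⟨ m≤n⇒∣m-n∣≡n∸m (n≤1+n (column u)) ⟩
      suc (column u) ∸ column u       ≡⟨ m+n∸n≡m 1 (column u) ⟩
      1                               ∎

  -- On a diagonal the column gap equals the row gap, which is at most 1 with two rows.
  adj⇒column-gap≤1 : ∀ {u v} → Adj P u v → ∣ column u - column v ∣ ≤ 1
  adj⇒column-gap≤1 {(i , _) , _} {(i′ , _) , _} (_ , eq) =
    subst (_≤ 1) eq (gap i i′)
    where
    gap : ∀ (i i′ : Fin 2) → ∣ toℕ i - toℕ i′ ∣ ≤ 1
    gap zero       zero       = z≤n
    gap zero       (suc zero) = s≤s z≤n
    gap (suc zero) zero       = s≤s z≤n
    gap (suc zero) (suc zero) = z≤n

  walk-right : ∀ k {u v} → column v ≡ k + column u → Walk P u v k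
  walk-right zero eq = subst (λ w → Walk P _ w 0) (column-injective (sym eq)) []
  walk-right (suc k) {u} {v} eq = column-adj u w column-w ∷ walk-right k {w} {v} (begin
    column v              ≡⟨ eq ⟩
    suc k + column u      ≡⟨ +-suc k (column u) ⟨
    k + suc (column u)    ≡⟨ cong (k +_) column-w ⟨
    k + column w          ∎)
    where
    open ≡-Reasoning
    in-range : suc (column u) < n
    in-range = ≤-<-trans (s≤s (m≤n+m (column u) k))
                         (subst (_< n) eq (Fin.toℕ<n (proj₂ (value v))))
    w = at (fromℕ< in-range)
    column-w : column w ≡ suc (column u)
    column-w = Fin.toℕ-fromℕ< in-range

  walk-left : ∀ k {u v} → column u ≡ k + column v → Walk P u v k
  walk-left zero eq = subst (λ w → Walk P _ w 0) (column-injective eq) []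
  walk-left (suc k) {u} {v} eq =
    adj-sym P {w} {u} (column-adj w u (trans eq (cong suc (sym column-w)))) ∷
    walk-left k {w} {v} column-w
    where
    in-range : k + column v < n
    -- Since `column u` is `suc k + column v`, the weak bound `column u ≤ n` is already the strict
    -- bound wanted here.
    in-range = subst (_≤ n) eq (<⇒≤ (Fin.toℕ<n (proj₂ (value u))))
    w = at (fromℕ< in-range)
    column-w : column w ≡ k + column v
    column-w = Fin.toℕ-fromℕ< in-range

  column-gap≤length : ∀ {u v} → Walk P u v m → ∣ column u - column v ∣ ≤ m
  column-gap≤length {u = u} [] = ≤-reflexive (∣n-n∣≡0 (column u))
  column-gap≤length {u = u} {v} (_∷_ {v = w} a p) = ≤-trans
    (∣-∣-triangle (column u) (column w) (column v))
    (+-mono-≤ (adj⇒column-gap≤1 {u} {w} a) (column-gap≤length p))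

  -- The colour class is a path ordered by column: the walks go straight left or right, and no step
  -- covers more than one column.
  pathMetric : Metric P
  pathMetric = record
    { dist     = λ u v → ∣ column u - column v ∣
    ; shortest = λ u v → walk u v , λ _ → column-gap≤length
    }
    where
    walk : ∀ u v → Walk P u v ∣ column u - column v ∣
    walk u v with ≤-total (column u) (column v)
    ... | inj₁ u≤v = walk-right _ (sym
      (trans (cong (_+ column u) (m≤n⇒∣m-n∣≡n∸m u≤v)) (m∸n+n≡m u≤v)))
    ... | inj₂ v≤u = walk-left _ (sym
      (trans (cong (_+ column v) (m≤n⇒∣n-m∣≡n∸m v≤u)) (m∸n+n≡m v≤u)))

  has-neighbour : 1 < n → ∀ u → ∃[ v ] Adj P u v
  has-neighbour 1<n u = go (column u) refl
    where
    go : ∀ c → column u ≡ c → ∃[ v ] Adj P u v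
    go zero eq =
      v , column-adj u v (trans (Fin.toℕ-fromℕ< 1<n) (cong suc (sym eq)))
      where
      v = at (fromℕ< 1<n)
    go (suc c) eq =
      v , adj-sym P {v} {u}
            (column-adj v u (trans eq (cong suc (sym (Fin.toℕ-fromℕ< c<n)))))
      where
      c<n : c < n
      c<n = subst (_≤ n) eq (<⇒≤ (Fin.toℕ<n (proj₂ (value u))))
      v = at (fromℕ< c<n)

singleton-not-resolving : Metric G → Metric H →
                          (∀ u → ∃[ u′ ] Adj G u u′) →
                          (∀ v → ∃[ v′ ] Adj H v v′) →
                          (S : Vec (Vertex (G □ H)) 1) → ¬ Resolving (G □ H) S
singleton-not-resolving {G} {H} M N nbrG nbrH ((u , v) ∷ []) res =
  let u′ , a = nbrG u
      v′ , b = nbrH v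
      eq = resolving⇒injective (M ⊞ N) res
             (cong (_∷ []) (trans (adj⇒dist≡1 (M ⊞ N) {u , v} (inj₁ (a , refl)))
                           (sym (adj⇒dist≡1 (M ⊞ N) {u , v} (inj₂ (refl , b))))))
  -- The two neighbours are `(u′ , v)` and `(u , v′)`; identifying them would make `u` adjacent to
  -- itself.
  in adj-irr G (sym (cong proj₁ eq)) a

-- Here `x + y` and `x + (N ∸ y)` are the distances of the grid point `(x , y)` from the corners
-- `(0 , 0)` and `(0 , N)`. Their sum `2 * x + N` determines `x`, and then the first distance
-- determines `y`.
grid-corners-injective : ∀ {N x x′ y y′} → y ≤ N → y′ ≤ N →
                         x + y ≡ x′ + y′ → x + (N ∸ y) ≡ x′ + (N ∸ y′) →
                         x ≡ x′ × y ≡ y′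
grid-corners-injective {N} {x} {x′} {y} {y′} y≤N y′≤N e₁ e₂ =
  x≡x′ , +-cancelˡ-≡ x y y′ (trans e₁ (cong (_+ y′) (sym x≡x′)))
  where
  open ≡-Reasoning
  double : ∀ x y → y ≤ N → (x + y) + (x + (N ∸ y)) ≡ 2 * x + N
  double x y y≤N = begin
    (x + y) + (x + (N ∸ y))   ≡⟨ rearrange x y (N ∸ y) ⟩
    2 * x + (N ∸ y + y)       ≡⟨ cong (2 * x +_) (m∸n+n≡m y≤N) ⟩
    2 * x + N                 ∎
    where
    rearrange : ∀ x y z → (x + y) + (x + z) ≡ 2 * x + (z + y)
    rearrange = solve-∀
  x≡x′ : x ≡ x′
  x≡x′ = *-cancelˡ-≡ x x′ 2 (+-cancelʳ-≡ N (2 * x) (2 * x′) (begin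
    2 * x + N                     ≡⟨ double x y y≤N ⟨
    (x + y) + (x + (N ∸ y))       ≡⟨ cong₂ _+_ e₁ e₂ ⟩
    (x′ + y′) + (x′ + (N ∸ y′))   ≡⟨ double x′ y′ y′≤N ⟩
    2 * x′ + N                    ∎))

twoRows-dimension : ∀ n → HasMetricDimension (gameGraph 2 (2 + n)) 2
twoRows-dimension n = metricDimension metric unique
  (injective⇒resolving metric corners-injective)
  (singleton-not-resolving L.pathMetric D.pathMetric
    (L.has-neighbour (s≤s z<s)) (D.has-neighbour (s≤s z<s)))
  where
  module L = TwoRows 0ℙ (2 + n)
  module D = TwoRows 1ℙ (2 + n)
  metric : Metric (gameGraph 2 (2 + n))
  metric = L.pathMetric ⊞ D.pathMetric

  N : ℕ
  N = suc n

  last : Fin (2 + n)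
  last = fromℕ N

  corners : Vec (Vertex (gameGraph 2 (2 + n))) 2
  corners = (L.at zero , D.at zero) ∷ (L.at zero , D.at last) ∷ []

  unique : Unique corners
  unique = ((λ eq → Fin.0≢1+n (cong (λ v → proj₂ (value (proj₂ v))) eq)) ∷ [])
         ∷ [] ∷ []

  column≤N : ∀ v → D.column v ≤ N
  column≤N v = Fin.toℕ≤pred[n] (proj₂ (value v))

  from-last : ∀ v → ∣ toℕ last - D.column v ∣ ≡ N ∸ D.column v
  from-last v = trans (cong (∣_- D.column v ∣) (Fin.toℕ-fromℕ N))
                      (m≤n⇒∣n-m∣≡n∸m (column≤N v))

  corners-injective : Injective _≡_ _≡_ (vector metric corners)
  corners-injective {u , v} {u′ , v′} eq =
    -- Distances from column 0 reduce by computation to the column itself, so `e₁` needs no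
    -- rewriting; only distances from `last` do.
    let e₁ , eq′ = ∷-injective eq
        e₂ , _   = ∷-injective eq′
        x , y    = grid-corners-injective (column≤N v) (column≤N v′) e₁
                     (subst₂ (λ d d′ → L.column u + d ≡ L.column u′ + d′)
                             (from-last v) (from-last v′) e₂)
    in cong₂ _,_ (L.column-injective x) (D.column-injective y)

-- Graphs of diameter at most two

module _ {G : SimpleGraph}
         (_≟ᵥ_ : DecidableEquality (Vertex G)) (adj? : Decidable (Adj G)) where

  -- The default value 2 is the true distance only when the diameter is at most 2, which
  -- `diameter₂Metric` assumes.
  distance₂ : Vertex G → Vertex G → ℕ
  distance₂ u v =
    if does (u ≟ᵥ v) then 0 else if does (adj? u v) then 1 else 2

  distance₂≤2 : ∀ u v → distance₂ u v ≤ 2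
  distance₂≤2 u v with u ≟ᵥ v | adj? u v
  ... | yes _ | _     = z≤n
  ... | no _  | yes _ = s≤s z≤n
  ... | no _  | no _  = ≤-refl

  diameter₂Metric : (∀ u v → u ≡ v ⊎ Adj G u v ⊎ ∃[ w ] Adj G u w × Adj G w v) →
                    Metric G
  diameter₂Metric near = record { dist = distance₂ ; shortest = isDistance }
    where
    isDistance : ∀ u v → IsDistance G u v (distance₂ u v)
    isDistance u v with u ≟ᵥ v | adj? u v
    ... | yes refl | _     = [] , λ _ _ → z≤n
    ... | no u≢v   | yes a = a ∷ [] , λ where
      zero    p → contradiction (walk-zero p) u≢v
      (suc _) _ → s≤s z≤n
    ... | no u≢v   | no ¬a with near u v
    ...   | inj₁ u≡v                   = contradiction u≡v u≢v
    ...   | inj₂ (inj₁ a)              = contradiction a ¬a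
    ...   | inj₂ (inj₂ (w , a , b))    = a ∷ b ∷ [] , λ where
      _ []          → contradiction refl u≢v
      _ (a ∷ [])    → contradiction a ¬a
      _ (_ ∷ _ ∷ _) → s≤s (s≤s z≤n)

-- The enumeration serves two purposes: injectivity bounds the order from below for the counting
-- argument, and surjectivity reduces statements about all vertices to finite searches over `Fin k`.
record Diameter₂ (G : SimpleGraph) (k : ℕ) : Set where
  field
    vertex            : Fin k → Vertex G
    vertex-injective  : Injective _≡_ _≡_ vertex
    vertex-surjective : ∀ v → ∃[ i ] vertex i ≡ v
    metric            : Metric G
    dist≤2            : ∀ u v → dist metric u v ≤ 2

module _ {p : Parity} {a b : ℕ} where

  private
    C = colourClass p a b

    _≟ₛ_ : DecidableEquality (Square a b)
    _≟ₛ_ = ≡-dec Fin._≟_ Fin._≟_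

    _≟ᵥ_ : DecidableEquality (Vertex C)
    _≟ᵥ_ = Refinement._≟_ _≟ₛ_

    adj? : Decidable (Adj C)
    adj? ((i , j) , _) ((i′ , j′) , _) =
      ¬? ((i , j) ≟ₛ (i′ , j′)) ×-dec
      (∣ toℕ i - toℕ i′ ∣ ≟ℕ ∣ toℕ j - toℕ j′ ∣)

  module _ (squares : Vec (Vertex C) k) where

    private
      sq : Fin k → Vertex C
      sq = lookup squares

    distinct? : Dec (∀ i j → sq i ≡ sq j → i ≡ j)
    distinct? = Fin.all? λ i → Fin.all? λ j → (sq i ≟ᵥ sq j) →-dec (i Fin.≟ j)

    exhaustive? : Dec (∀ i j → squareParity (i , j) ≡ p →
                       ∃[ l ] value (sq l) ≡ (i , j))
    exhaustive? = Fin.all? λ i → Fin.all? λ j →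
      (squareParity (i , j) ℙ.≟ p) →-dec
      Fin.any? λ l → value (sq l) ≟ₛ (i , j)

    near? : Dec (∀ i j → sq i ≡ sq j ⊎ Adj C (sq i) (sq j) ⊎
                 ∃[ l ] Adj C (sq i) (sq l) × Adj C (sq l) (sq j))
    near? = Fin.all? λ i → Fin.all? λ j →
      (sq i ≟ᵥ sq j) ⊎-dec adj? (sq i) (sq j) ⊎-dec
      Fin.any? λ l → adj? (sq i) (sq l) ×-dec adj? (sq l) (sq j)

    -- For an explicit list of squares the three `True` arguments are found by evaluating the
    -- decision procedures.
    diameter₂ : {True distinct?} → {True exhaustive?} → {True near?} →
                Diameter₂ C k
    diameter₂ {distinct} {exhaustive} {close} = record
      { vertex            = sq
      ; vertex-injective  = λ {i} {j} → toWitness {a? = distinct?} distinct i j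
      ; vertex-surjective = surjective
      ; metric            = diameter₂Metric {G = C} _≟ᵥ_ adj? near
      ; dist≤2            = distance₂≤2 {G = C} _≟ᵥ_ adj?
      }
      where
      surjective : ∀ v → ∃[ i ] sq i ≡ v
      surjective v@((i , j) , _) =
        let l , eq = toWitness {a? = exhaustive?} exhaustive i j (parity-proof v)
        in l , value-injective eq
      near : ∀ u v → u ≡ v ⊎ Adj C u v ⊎ ∃[ w ] Adj C u w × Adj C w v
      near u v with surjective u | surjective v
      ... | i , refl | j , refl with toWitness {a? = near?} close i j
      ...   | inj₁ eq                    = inj₁ eq
      ...   | inj₂ (inj₁ a)              = inj₂ (inj₁ a)
      ...   | inj₂ (inj₂ (l , a , b))    = inj₂ (inj₂ (sq l , a , b))

-- Counting distance vectors

module _ {r : ℕ} where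

  -- All pairs with first entry 0 share one code, and the remaining pairs with second entry 0 share
  -- another; the other `r * r` pairs get codes of their own.
  encode : Fin (suc r) → Fin (suc r) → Fin (2 + r * r)
  encode zero    _       = zero
  encode (suc _) zero    = suc zero
  encode (suc i) (suc j) = suc (suc (combine i j))

  encode-injective : ∀ i j i′ j′ → encode i j ≡ encode i′ j′ →
                     (i ≡ zero × i′ ≡ zero) ⊎ (j ≡ zero × j′ ≡ zero) ⊎
                     (i ≡ i′ × j ≡ j′)
  encode-injective zero    _       zero     _        _  = inj₁ (refl , refl)
  encode-injective zero    _       (suc _)  zero     ()
  encode-injective zero    _       (suc _)  (suc _)  ()
  encode-injective (suc _) zero    zero     _        ()
  encode-injective (suc _) (suc _) zero     _        ()
  encode-injective (suc _) zero    (suc _)  zero     _  = inj₂ (inj₁ (refl , refl))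
  encode-injective (suc _) zero    (suc _)  (suc _)  ()
  encode-injective (suc _) (suc _) (suc _)  zero     ()
  encode-injective (suc i) (suc j) (suc i′) (suc j′) eq =
    let i≡i′ , j≡j′ = Fin.combine-injective i j i′ j′
                        (Fin.suc-injective (Fin.suc-injective eq))
    in inj₂ (inj₂ (cong suc i≡i′ , cong suc j≡j′))

  -- The collisions of `encode` are harmless: two vertices at distance 0 from the same `uᵢ` both
  -- equal `uᵢ`. So the code is injective on vertices, and the pigeonhole principle bounds their
  -- number.
  resolving-pair⇒order≤ :
    (M : Metric G) → (∀ u v → dist M u v ≤ r) →
    {f : Fin n → Vertex G} → Injective _≡_ _≡_ f →
    ∀ {u₁ u₂} → Resolving G (u₁ ∷ u₂ ∷ []) → n ≤ 2 + r * r
  resolving-pair⇒order≤ {G = G} M dist≤r f-inj {u₁} {u₂} res =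
    Fin.injective⇒≤ (f-inj ∘ code-injective)
    where
    d : Vertex G → Vertex G → Fin (suc r)
    d u v = fromℕ< (s≤s (dist≤r u v))

    d-zero : ∀ {u v} → d u v ≡ zero → u ≡ v
    d-zero {u} {v} eq = dist≡0⇒≡ M (Fin.fromℕ<-injective _ 0 (s≤s (dist≤r u v)) z<s eq)

    code-injective : ∀ {v w} → encode (d u₁ v) (d u₂ v) ≡ encode (d u₁ w) (d u₂ w) →
                     v ≡ w
    code-injective {v} {w} eq with encode-injective (d u₁ v) (d u₂ v) _ _ eq
    ... | inj₁ (z , z′)        = trans (sym (d-zero z)) (d-zero z′)
    ... | inj₂ (inj₁ (z , z′)) = trans (sym (d-zero z)) (d-zero z′)
    ... | inj₂ (inj₂ (e₁ , e₂)) = resolving⇒injective M res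
      (cong₂ (λ x y → x ∷ y ∷ [])
        (Fin.fromℕ<-injective _ _ (s≤s (dist≤r u₁ v)) (s≤s (dist≤r u₁ w)) e₁)
        (Fin.fromℕ<-injective _ _ (s≤s (dist≤r u₂ v)) (s≤s (dist≤r u₂ w)) e₂))

module Product₂ (𝐆 : Diameter₂ G k) (𝐇 : Diameter₂ H l) where

  private
    module G = Diameter₂ 𝐆
    module H = Diameter₂ 𝐇

  productMetric : Metric (G □ H)
  productMetric = G.metric ⊞ H.metric

  productVertex : Fin (k * l) → Vertex (G □ H)
  productVertex x = let i , j = remQuot {k} l x in G.vertex i , H.vertex j

  productVertex-injective : Injective _≡_ _≡_ productVertex
  productVertex-injective {x} {y} eq = begin
    x                                ≡⟨ Fin.combine-remQuot {k} l x ⟨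
    uncurry combine (remQuot {k} l x)    ≡⟨ cong₂ combine
                                          (G.vertex-injective (cong proj₁ eq))
                                          (H.vertex-injective (cong proj₂ eq)) ⟩
    uncurry combine (remQuot {k} l y)    ≡⟨ Fin.combine-remQuot {k} l y ⟩
    y                                ∎
    where open ≡-Reasoning

  pair-not-resolving : 18 < k * l →
                       (S : Vec (Vertex (G □ H)) 2) → ¬ Resolving (G □ H) S
  pair-not-resolving 18<kl (_ ∷ _ ∷ []) res = <⇒≱ 18<kl
    -- Each factor contributes at most 2 to a distance, so `r = 4` and the bound is 2 + 4 * 4 = 18.
    (resolving-pair⇒order≤ {r = 4} productMetric
      (λ (u , v) (u′ , v′) → +-mono-≤ (G.dist≤2 u u′) (H.dist≤2 v v′))
      productVertex-injective res)

  module _ (S : Vec (Vertex (G □ H)) m) where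

    -- Quantifying over indices makes injectivity of the distance vector a finite search;
    -- `resolving` carries the result over to vertices by surjectivity.
    resolving? : Dec (∀ i j i′ j′ →
      vector productMetric S (G.vertex i , H.vertex j) ≡
      vector productMetric S (G.vertex i′ , H.vertex j′) → i ≡ i′ × j ≡ j′)
    resolving? = Fin.all? λ i → Fin.all? λ j → Fin.all? λ i′ → Fin.all? λ j′ →
      Vec.≡-dec _≟ℕ_ _ _ →-dec
      ((i Fin.≟ i′) ×-dec (j Fin.≟ j′))

    resolving : True resolving? → Resolving (G □ H) S
    resolving t = injective⇒resolving productMetric inj
      where
      inj : Injective _≡_ _≡_ (vector productMetric S)
      inj {u , v} {u′ , v′} eq
        with G.vertex-surjective u | H.vertex-surjective v
           | G.vertex-surjective u′ | H.vertex-surjective v′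
      ... | i , refl | j , refl | i′ , refl | j′ , refl =
        let i≡i′ , j≡j′ = toWitness {a? = resolving?} t i j i′ j′ eq
        in cong₂ _,_ (cong G.vertex i≡i′) (cong H.vertex j≡j′)

  dimension-three : 18 < k * l → {S : Vec (Vertex (G □ H)) 3} →
                    Unique S → True (resolving? S) → HasMetricDimension (G □ H) 3
  dimension-three 18<kl {S} S! t =
    metricDimension productMetric S! (resolving S t) (pair-not-resolving 18<kl)

-- Boards with three rows

private
  pattern 0F = zero
  pattern 1F = suc zero
  pattern 2F = suc (suc zero)
  pattern 3F = suc (suc (suc zero))

-- Two triangles sharing the centre square.
light₃₃ : Diameter₂ (lightBishopGraph 3 3) 5
light₃₃ = diameter₂
  ( ((0F , 0F) , [ refl ]) ∷ ((0F , 2F) , [ refl ]) ∷ ((1F , 1F) , [ refl ])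
  ∷ ((2F , 0F) , [ refl ]) ∷ ((2F , 2F) , [ refl ]) ∷ [])

-- A 4-cycle.
dark₃₃ : Diameter₂ (darkBishopGraph 3 3) 4
dark₃₃ = diameter₂
  ( ((0F , 1F) , [ refl ]) ∷ ((1F , 0F) , [ refl ])
  ∷ ((1F , 2F) , [ refl ]) ∷ ((2F , 1F) , [ refl ]) ∷ [])

light₃₄ : Diameter₂ (lightBishopGraph 3 4) 6
light₃₄ = diameter₂
  ( ((0F , 0F) , [ refl ]) ∷ ((0F , 2F) , [ refl ]) ∷ ((1F , 1F) , [ refl ])
  ∷ ((1F , 3F) , [ refl ]) ∷ ((2F , 0F) , [ refl ]) ∷ ((2F , 2F) , [ refl ]) ∷ [])

-- The mirror image of the light graph: reversing the four columns exchanges the colours.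
dark₃₄ : Diameter₂ (darkBishopGraph 3 4) 6
dark₃₄ = diameter₂
  ( ((0F , 1F) , [ refl ]) ∷ ((0F , 3F) , [ refl ]) ∷ ((1F , 0F) , [ refl ])
  ∷ ((1F , 2F) , [ refl ]) ∷ ((2F , 1F) , [ refl ]) ∷ ((2F , 3F) , [ refl ]) ∷ [])

dimension₃₃ : HasMetricDimension (gameGraph 3 3) 3
-- The product has 5 * 4 = 20 = 19 + 1 vertices, more than 18.
dimension₃₃ = Product₂.dimension-three light₃₃ dark₃₃ (m≤m+n 19 1)
  { (((0F , 0F) , [ refl ]) , ((0F , 1F) , [ refl ]))
  ∷ (((0F , 0F) , [ refl ]) , ((1F , 0F) , [ refl ]))
  ∷ (((0F , 2F) , [ refl ]) , ((0F , 1F) , [ refl ])) ∷ [] }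
  -- The final `_` is the evidence that the triple resolves, obtained by evaluating `resolving?`
  -- over all pairs of vertices.
  (((λ ()) ∷ (λ ()) ∷ []) ∷ ((λ ()) ∷ []) ∷ [] ∷ []) _

dimension₃₄ : HasMetricDimension (gameGraph 3 4) 3
-- Here there are 6 * 6 = 36 = 19 + 17 vertices.
dimension₃₄ = Product₂.dimension-three light₃₄ dark₃₄ (m≤m+n 19 17)
  { (((0F , 0F) , [ refl ]) , ((0F , 1F) , [ refl ]))
  ∷ (((1F , 3F) , [ refl ]) , ((1F , 0F) , [ refl ]))
  ∷ (((1F , 3F) , [ refl ]) , ((2F , 3F) , [ refl ])) ∷ [] }
  (((λ ()) ∷ (λ ()) ∷ []) ∷ ((λ ()) ∷ []) ∷ [] ∷ []) _

theorem5p2 : (∀ (n : ℕ) → 1 < n → HasMetricDimension (gameGraph 2 n) 2)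
    × (HasMetricDimension (gameGraph 3 3) 3 × HasMetricDimension (gameGraph 3 4) 3)
theorem5p2 =
  (λ { (suc (suc n)) _ → twoRows-dimension n ; (suc zero) (s≤s ()) }) ,
  dimension₃₃ , dimension₃₄
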